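{- For integers $k\ge0$ put $\zeta(-k|z)=-\frac{B_{k+1}(z)}{k+1}$, and for $r\ge2$ and integers $k_1,\ldots,k_r\ge0$ define recursively \[ \zeta(-k_1,\ldots,-k_r|z)=-\frac{1}{k_r+1}\zeta(-k_1,\ldots,-k_{r-2},-k_{r-1}-k_r-1|z)-\frac12\zeta(-k_1,\ldots,-k_{r-2},-k_{r-1}-k_r|z) \] \[ +\sum_{q=1}^{k_r}(-k_r)_q\frac{B_{q+1}}{(q+1)!}\zeta(-k_1,\ldots,-k_{r-2},-k_{r-1}-k_r+q|z), \] and let the depth-zero value be $1$. Then, up to addition of a function of period $1$, these are the solutions of the system of difference equations \[ V(-k_1,\ldots,-k_r|z+1)-V(-k_1,\ldots,-k_r|z)=-z^{k_1}V(-k_2,\ldots,-k_r|z+1)\qquad(r\ge1,\ k_j\ge0); \] that is, the polynomials $\zeta(-k_1,\ldots,-k_r|z)$ satisfy this system, and for each fixed tuple any solution $V(-k_1,\ldots,-k_r|z)$ of the equation with right-hand side $-z^{k_1}\zeta(-k_2,\ldots,-k_r|z+1)$ differs from $\zeta(-k_1,\ldots,-k_r|z)$ by a function of period $1$.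
   Context: $B_n(z)$ denotes the $n$-th Bernoulli polynomial and $B_n=B_n(0)$ the $n$-th Bernoulli number. $(a)_q=a(a+1)\cdots(a+q-1)$ is the Pochhammer symbol. For $r=2$ the prefix $-k_1,\ldots,-k_{r-2}$ is empty. -}

module Defs where

open import Algebra.Bundles using (CommutativeRing)
open import Algebra.Morphism.Structures using (module RingMorphisms)
import Algebra.Properties.Semiring.Exp as Exp
import Algebra.Properties.Semiring.Sum as Sum
open import Data.Fin.Base using (Fin; toℕ)
open import Data.Fin.Properties using (toℕ<n)
open import Data.Integer.Base as ℤ using (ℤ; +_)
open import Data.Nat.Base as ℕ using (ℕ; zero; suc; _∸_; _!; _<_)
open import Data.Nat.Combinatorics using (_C_)
open import Data.Nat.Induction using (<-wellFounded)
open import Data.Nat.Properties using (_!≢0)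
open import Data.Rational.Base as ℚ using (ℚ; _/_; 1ℚ; ½)
import Data.Rational.Properties as ℚ
open import Data.Vec.Base using (Vec; []; _∷_; _∷ʳ_; init; last)
open import Function.Bundles using (Func)
open import Induction.WellFounded using (Acc; acc)
open import Level using (Level; _⊔_)

module ℚ-Sum = Sum (CommutativeRing.semiring ℚ.+-*-commutativeRing)

pochhammer : ℤ → ℕ → ℤ
pochhammer a zero    = + 1
pochhammer a (suc q) = pochhammer a q ℤ.* (a ℤ.+ + q)

binomial : ℕ → ℕ → ℚ
binomial n j = + (n C j) / 1

-- The coefficient of tᵐ⁺² in (eᵗ - 1) · Σₙ Bₙ tⁿ / n! = t says
-- Σ_{j ≤ m+1} C(m+2, j) Bⱼ = 0; solving for B_{m+1} gives the second clause.
-- In particular B₁ = -1/2.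
bernoulliAcc : ∀ n → Acc _<_ n → ℚ
bernoulliAcc zero    _        = 1ℚ
bernoulliAcc (suc m) (acc rs) =
  ℚ.- ((+ 1 / suc (suc m)) ℚ.*
       ℚ-Sum.sum {suc m} λ j →
         binomial (suc (suc m)) (toℕ j) ℚ.* bernoulliAcc (toℕ j) (rs (toℕ<n j)))

bernoulli : ℕ → ℚ
bernoulli n = bernoulliAcc n (<-wellFounded n)

-- (-k)_q B_{q+1} / (q+1)!
coefficient : ℕ → ℕ → ℚ
coefficient k q =
  (pochhammer (ℤ.- + k) q / 1) ℚ.* bernoulli (suc q) ℚ.*
  (_/_ (+ 1) (suc q !) {{suc q !≢0}})

-- A commutative ring A with a unital ring homomorphism ι : ℚ → A, that is, a
-- commutative ℚ-algebra.  The variable z ranges over A, as it does over the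
-- complex numbers classically.
module MultipleZeta
  {c ℓ : Level} (A : CommutativeRing c ℓ) (ι : ℚ → CommutativeRing.Carrier A) where

  open CommutativeRing A
  open Exp semiring using (_^_)
  open Sum semiring using (sum-syntax; sum⁺-syntax)

  IsℚAlgebra : Set ℓ
  IsℚAlgebra = IsRingHomomorphism ι
    where open RingMorphisms ℚ.+-*-rawRing rawRing

  -- Bₙ(z) = Σ_{j ≤ n} C(n, j) Bⱼ zⁿ⁻ʲ, from t eᶻᵗ / (eᵗ - 1) = Σₙ Bₙ(z) tⁿ / n!
  bernoulliPoly : ℕ → Carrier → Carrier
  bernoulliPoly n z =
    ∑[ j ≤ n ] (ι (binomial n (toℕ j) ℚ.* bernoulli (toℕ j)) * z ^ (n ∸ toℕ j))

  -- ζ (k₁ ∷ … ∷ kᵣ ∷ []) z is ζ(-k₁,…,-kᵣ|z).  The entries are the kⱼ rather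
  -- than the arguments -kⱼ, so -k_{r-1} - kᵣ + q is encoded as k_{r-1} + kᵣ ∸ q,
  -- where no truncation occurs since q ≤ kᵣ.
  ζ : ∀ {r} → Vec ℕ r → Carrier → Carrier
  ζ {zero}        []       z = 1#
  ζ {suc zero}    (k ∷ []) z = - (ι (+ 1 / suc k) * bernoulliPoly (suc k) z)
  ζ {suc (suc r)} ks       z =
      - (ι (+ 1 / suc k) * ζ (prefix ∷ʳ (k′ ℕ.+ k ℕ.+ 1)) z)
      - ι ½ * ζ (prefix ∷ʳ (k′ ℕ.+ k)) z
      + ∑[ i < k ] (let q = suc (toℕ i) in
          ι (coefficient k q) * ζ (prefix ∷ʳ (k′ ℕ.+ k ∸ q)) z)
    where
    prefix = init (init ks)
    k′     = last (init ks)
    k      = last ks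

  -- The equation V(z+1) - V(z) = -zᵏ W(z+1).
  SolvesEquation : ℕ → (W V : Carrier → Carrier) → Set (c ⊔ ℓ)
  SolvesEquation k W V = ∀ z → V (z + 1#) - V z ≈ - (z ^ k) * W (z + 1#)

  record SolvesSystem (V : ∀ {r} → Vec ℕ r → Carrier → Carrier) : Set (c ⊔ ℓ) where
    field
      depth-zero : ∀ z → V [] z ≈ 1#
      difference : ∀ {r} k (ks : Vec ℕ r) → SolvesEquation k (V ks) (V (k ∷ ks))

  Function : Set (c ⊔ ℓ)
  Function = Func setoid setoid

  HasPeriodOne : Function → Set (c ⊔ ℓ)
  HasPeriodOne P = ∀ z → Func.to P (z + 1#) ≈ Func.to P z

{-# OPTIONS --safe #-}

-- The recursion for ζ is linear in the values of lower depth, and for r ≥ 3 these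
-- values all carry the leading index k₁, so the difference equation passes from
-- depth r - 1 to depth r.  For r = 1 it is B_{k+1}(z+1) - B_{k+1}(z) = (k+1) zᵏ.
-- For r = 2 the difference of the right-hand side is -z^{k₁} times a polynomial
-- which has to be ζ(-k₂|z+1); expanding Bₙ(z+1) = Σ C(n, j) (-1)ʲ Bⱼ zⁿ⁻ʲ
-- identifies the two coefficient by coefficient.
module Submission where

open import Defs
open import Algebra.Bundles using (CommutativeRing)
import Algebra.Morphism.Construct.Identity as Identity
open import Algebra.Morphism.Structures using (module RingMorphisms)
import Algebra.Properties.AbelianGroup as AbelianGroupProperties
import Algebra.Properties.Ring as RingProperties
import Algebra.Properties.Semiring.Exp as Exp
import Algebra.Properties.Semiring.Sum as Sum
import Algebra.Solver.Ring.NaturalCoefficients.Default as SemiringSolver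
open import Data.Fin.Base using (Fin; toℕ; opposite)
open import Data.Fin.Permutation using (reverse)
open import Data.Fin.Properties using (toℕ<n; toℕ≤pred[n]; opposite-prop)
open import Data.Integer.Base as ℤ using (ℤ; +_)
import Data.Integer.Properties as ℤ
open import Data.Nat.Base as ℕ using (ℕ; zero; suc; _∸_; _!; _≤_; _<_; z≤n; s≤s)
open import Data.Nat.Combinatorics using
  ( _C_; nC1≡n; nCn≡1; nCk≡n!/k![n-k]!; nCk≡nC[n∸k]; k>n⇒nCk≡0; k![n∸k]!∣n!
  ; [n-k]*[n-k-1]!≡[n-k]!; nCk+nC[k+1]≡[n+1]C[k+1])
open import Data.Nat.DivMod using (m/n*n≡m)
open import Data.Nat.Induction using (<-rec; <-wellFounded)
import Data.Nat.Properties as ℕ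
open import Data.Nat.Tactic.RingSolver using (solve-∀)
open import Data.Product.Base using (_×_; _,_; ∃-syntax)
open import Data.Rational.Base as ℚ using (ℚ; _/_; 0ℚ; 1ℚ; ½)
import Data.Rational.Properties as ℚ
open import Data.Rational.Solver using (module +-*-Solver)
import Data.Rational.Unnormalised.Base as ℚᵘ
import Data.Rational.Unnormalised.Properties as ℚᵘ
open import Data.Vec.Base using (Vec; []; _∷_; _∷ʳ_; init; last)
open import Function.Base using (id; _∘′_)
open import Function.Bundles using (Func)
open import Induction.WellFounded using (Acc; acc)
open import Relation.Binary.PropositionalEquality as ≡ using (_≡_)
import Relation.Binary.Reasoning.Setoid as SetoidReasoning
open import Relation.Nullary using (¬_; yes; no)

module BinomialCoefficients where

  open ≡

  nCk*k![n∸k]!≡n! : ∀ {n k} → k ≤ n → (n C k) ℕ.* (k ! ℕ.* (n ∸ k) !) ≡ n !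
  nCk*k![n∸k]!≡n! {n} {k} k≤n = trans
    (cong (ℕ._* (k ! ℕ.* (n ∸ k) !)) (nCk≡n!/k![n-k]! k≤n))
    (m/n*n≡m (k![n∸k]!∣n! k≤n))
    where instance _ = k ℕ.!* (n ∸ k) !≢0

  [1+n]Cn≡1+n : ∀ n → suc n C n ≡ suc n
  [1+n]Cn≡1+n n = begin
    suc n C n           ≡⟨ nCk≡nC[n∸k] (ℕ.n≤1+n n) ⟩
    suc n C (suc n ∸ n) ≡⟨ cong (suc n C_) (ℕ.m+n∸n≡m 1 n) ⟩
    suc n C 1           ≡⟨ nC1≡n (suc n) ⟩
    suc n               ∎
    where open ≡-Reasoning

  [1+k]*nC[1+k]≡[n∸k]*nCk : ∀ n k → suc k ℕ.* (n C suc k) ≡ (n ∸ k) ℕ.* (n C k)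
  [1+k]*nC[1+k]≡[n∸k]*nCk n k with k ℕ.<? n
  ... | no k≮n
    rewrite k>n⇒nCk≡0 (s≤s (ℕ.≮⇒≥ k≮n)) | ℕ.m≤n⇒m∸n≡0 (ℕ.≮⇒≥ k≮n) = ℕ.*-zeroʳ (suc k)
  ... | yes k<n = ℕ.*-cancelʳ-≡ _ _ (k ! ℕ.* (n ∸ suc k) !) (begin
    suc k ℕ.* c′ ℕ.* (k ! ℕ.* m !)         ≡⟨ shuffle₁ (suc k) c′ (k !) (m !) ⟩
    c′ ℕ.* (suc k ! ℕ.* m !)               ≡⟨ nCk*k![n∸k]!≡n! k<n ⟩
    n !                                    ≡⟨ nCk*k![n∸k]!≡n! (ℕ.<⇒≤ k<n) ⟨
    c ℕ.* (k ! ℕ.* (n ∸ k) !)              ≡⟨ cong (λ x → c ℕ.* (k ! ℕ.* x)) ([n-k]*[n-k-1]!≡[n-k]! k<n) ⟨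
    c ℕ.* (k ! ℕ.* ((n ∸ k) ℕ.* m !))      ≡⟨ shuffle₂ c (k !) (n ∸ k) (m !) ⟩
    (n ∸ k) ℕ.* c ℕ.* (k ! ℕ.* m !)        ∎)
    where
    open ≡-Reasoning
    m  = n ∸ suc k
    c  = n C k
    c′ = n C suc k
    instance _ = k ℕ.!* m !≢0
    shuffle₁ : ∀ a c x y → a ℕ.* c ℕ.* (x ℕ.* y) ≡ c ℕ.* (a ℕ.* x ℕ.* y)
    shuffle₁ = solve-∀
    shuffle₂ : ∀ c x a y → c ℕ.* (x ℕ.* (a ℕ.* y)) ≡ a ℕ.* c ℕ.* (x ℕ.* y)
    shuffle₂ = solve-∀

  nCj*[n∸j]Ci*j!i![n∸j∸i]!≡n! : ∀ {n} i j → i ℕ.+ j ≤ n →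
    (n C j) ℕ.* ((n ∸ j) C i) ℕ.* (i ! ℕ.* j ! ℕ.* (n ∸ (i ℕ.+ j)) !) ≡ n !
  nCj*[n∸j]Ci*j!i![n∸j∸i]!≡n! {n} i j i+j≤n = begin
    (n C j) ℕ.* ((n ∸ j) C i) ℕ.* (i ! ℕ.* j ! ℕ.* (n ∸ (i ℕ.+ j)) !)
      ≡⟨ cong (λ m → (n C j) ℕ.* ((n ∸ j) C i) ℕ.* (i ! ℕ.* j ! ℕ.* m !))
           (trans (cong (n ∸_) (ℕ.+-comm i j)) (sym (ℕ.∸-+-assoc n j i))) ⟩
    (n C j) ℕ.* ((n ∸ j) C i) ℕ.* (i ! ℕ.* j ! ℕ.* (n ∸ j ∸ i) !)
      ≡⟨ shuffle (n C j) ((n ∸ j) C i) (i !) (j !) ((n ∸ j ∸ i) !) ⟩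
    (n C j) ℕ.* (j ! ℕ.* (((n ∸ j) C i) ℕ.* (i ! ℕ.* (n ∸ j ∸ i) !)))
      ≡⟨ cong (λ x → (n C j) ℕ.* (j ! ℕ.* x)) (nCk*k![n∸k]!≡n! (ℕ.m+n≤o⇒m≤o∸n i i+j≤n)) ⟩
    (n C j) ℕ.* (j ! ℕ.* (n ∸ j) !)
      ≡⟨ nCk*k![n∸k]!≡n! (ℕ.m+n≤o⇒n≤o i i+j≤n) ⟩
    n ! ∎
    where
    open ≡-Reasoning
    shuffle : ∀ a b x y z → a ℕ.* b ℕ.* (x ℕ.* y ℕ.* z) ≡ a ℕ.* (y ℕ.* (b ℕ.* (x ℕ.* z)))
    shuffle = solve-∀

  nCj*[n∸j]Ci≡nCi*[n∸i]Cj : ∀ {n i j} → i ≤ n → j ≤ n →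
    (n C j) ℕ.* ((n ∸ j) C i) ≡ (n C i) ℕ.* ((n ∸ i) C j)
  nCj*[n∸j]Ci≡nCi*[n∸i]Cj {n} {i} {j} i≤n j≤n with i ℕ.+ j ℕ.≤? n
  ... | no i+j≰n = trans (vanish j i (n∸x<y j≤n i+j≰n))
                     (sym (vanish i j (n∸x<y i≤n (i+j≰n ∘′ subst (_≤ n) (ℕ.+-comm j i)))))
    where
    n∸x<y : ∀ {x y} → x ≤ n → ¬ (y ℕ.+ x ≤ n) → n ∸ x < y
    n∸x<y {x} {y} x≤n y+x≰n = ℕ.≰⇒> λ y≤n∸x → y+x≰n (ℕ.m≤o∸n⇒m+n≤o y x≤n y≤n∸x)
    vanish : ∀ x y → n ∸ x < y → (n C x) ℕ.* ((n ∸ x) C y) ≡ 0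
    vanish x y lt = trans (cong ((n C x) ℕ.*_) (k>n⇒nCk≡0 lt)) (ℕ.*-zeroʳ (n C x))
  ... | yes i+j≤n = ℕ.*-cancelʳ-≡ _ _ (i ! ℕ.* j ! ℕ.* (n ∸ (i ℕ.+ j)) !) (begin
    (n C j) ℕ.* ((n ∸ j) C i) ℕ.* (i ! ℕ.* j ! ℕ.* (n ∸ (i ℕ.+ j)) !)
      ≡⟨ nCj*[n∸j]Ci*j!i![n∸j∸i]!≡n! i j i+j≤n ⟩
    n !
      ≡⟨ nCj*[n∸j]Ci*j!i![n∸j∸i]!≡n! j i (subst (_≤ n) (ℕ.+-comm i j) i+j≤n) ⟨
    (n C i) ℕ.* ((n ∸ i) C j) ℕ.* (j ! ℕ.* i ! ℕ.* (n ∸ (j ℕ.+ i)) !)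
      ≡⟨ cong₂ (λ x y → (n C i) ℕ.* ((n ∸ i) C j) ℕ.* (x ℕ.* (n ∸ y) !))
           (ℕ.*-comm (j !) (i !)) (ℕ.+-comm j i) ⟩
    (n C i) ℕ.* ((n ∸ i) C j) ℕ.* (i ! ℕ.* j ! ℕ.* (n ∸ (i ℕ.+ j)) !) ∎)
    where
    open ≡-Reasoning
    instance
      _ = i ℕ.!* j !≢0
      _ = (n ∸ (i ℕ.+ j)) ℕ.!≢0
      _ = ℕ.m*n≢0 (i ! ℕ.* j !) ((n ∸ (i ℕ.+ j)) !)

  /1-homo-+ : ∀ i j → (i ℤ.+ j) / 1 ≡ (i / 1) ℚ.+ (j / 1)
  /1-homo-+ i j = ℚ.toℚᵘ-injective (begin-equality
    ℚ.toℚᵘ ((i ℤ.+ j) / 1)                ≃⟨ ℚ.toℚᵘ-fromℚᵘ (ℚᵘ.mkℚᵘ (i ℤ.+ j) 0) ⟩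
    ℚᵘ.mkℚᵘ (i ℤ.+ j) 0                   ≃⟨ ℚᵘ.*≡* (cong (ℤ._* + 1) (sym (cong₂ ℤ._+_ (ℤ.*-identityʳ i) (ℤ.*-identityʳ j)))) ⟩
    ℚᵘ.mkℚᵘ i 0 ℚᵘ.+ ℚᵘ.mkℚᵘ j 0          ≃⟨ ℚᵘ.+-cong (ℚ.toℚᵘ-fromℚᵘ (ℚᵘ.mkℚᵘ i 0)) (ℚ.toℚᵘ-fromℚᵘ (ℚᵘ.mkℚᵘ j 0)) ⟨
    ℚ.toℚᵘ (i / 1) ℚᵘ.+ ℚ.toℚᵘ (j / 1)    ≃⟨ ℚ.toℚᵘ-homo-+ (i / 1) (j / 1) ⟨
    ℚ.toℚᵘ ((i / 1) ℚ.+ (j / 1))              ∎)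
    where open ℚᵘ.≤-Reasoning

  /1-homo-* : ∀ i j → (i ℤ.* j) / 1 ≡ (i / 1) ℚ.* (j / 1)
  /1-homo-* i j = ℚ.toℚᵘ-injective (begin-equality
    ℚ.toℚᵘ ((i ℤ.* j) / 1)                ≃⟨ ℚ.toℚᵘ-fromℚᵘ (ℚᵘ.mkℚᵘ (i ℤ.* j) 0) ⟩
    ℚᵘ.mkℚᵘ i 0 ℚᵘ.* ℚᵘ.mkℚᵘ j 0          ≃⟨ ℚᵘ.*-cong (ℚ.toℚᵘ-fromℚᵘ (ℚᵘ.mkℚᵘ i 0)) (ℚ.toℚᵘ-fromℚᵘ (ℚᵘ.mkℚᵘ j 0)) ⟨
    ℚ.toℚᵘ (i / 1) ℚᵘ.* ℚ.toℚᵘ (j / 1)    ≃⟨ ℚ.toℚᵘ-homo-* (i / 1) (j / 1) ⟨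
    ℚ.toℚᵘ ((i / 1) ℚ.* (j / 1))              ∎)
    where open ℚᵘ.≤-Reasoning

  pos-*/1 : ∀ m n → + (m ℕ.* n) / 1 ≡ (+ m / 1) ℚ.* (+ n / 1)
  pos-*/1 m n = trans (cong (_/ 1) (ℤ.pos-* m n)) (/1-homo-* (+ m) (+ n))

  [1/n]*n≡1 : ∀ n .{{_ : ℕ.NonZero n}} → (+ 1 / n) ℚ.* (+ n / 1) ≡ 1ℚ
  [1/n]*n≡1 n@(suc m) = ℚ.toℚᵘ-injective (begin-equality
    ℚ.toℚᵘ ((+ 1 / n) ℚ.* (+ n / 1))             ≃⟨ ℚ.toℚᵘ-homo-* (+ 1 / n) (+ n / 1) ⟩
    ℚ.toℚᵘ (+ 1 / n) ℚᵘ.* ℚ.toℚᵘ (+ n / 1)       ≃⟨ ℚᵘ.*-cong (ℚ.toℚᵘ-fromℚᵘ (ℚᵘ.mkℚᵘ (+ 1) m)) (ℚ.toℚᵘ-fromℚᵘ (ℚᵘ.mkℚᵘ (+ n) 0)) ⟩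
    ℚᵘ.mkℚᵘ (+ 1) m ℚᵘ.* ℚᵘ.mkℚᵘ (+ n) 0         ≃⟨ ℚᵘ.*≡* (trans (cong (ℤ._* + 1) (ℤ.*-identityˡ (+ n)))
                                                      (trans (ℤ.*-comm (+ n) (+ 1)) (cong (λ x → + 1 ℤ.* + x) (sym (ℕ.*-identityʳ n))))) ⟩
    ℚᵘ.1ℚᵘ ∎)
    where open ℚᵘ.≤-Reasoning

  pascal : ∀ n k → binomial (suc n) (suc k) ≡ binomial n k ℚ.+ binomial n (suc k)
  pascal n k = trans
    (cong (λ x → + x / 1) (sym (nCk+nC[k+1]≡[n+1]C[k+1] n k)))
    (/1-homo-+ (+ (n C k)) (+ (n C suc k)))

  binomial-swap : ∀ {n i j} → i ≤ n → j ≤ n →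
    binomial n j ℚ.* binomial (n ∸ j) i ≡ binomial n i ℚ.* binomial (n ∸ i) j
  binomial-swap {n} {i} {j} i≤n j≤n = begin
    binomial n j ℚ.* binomial (n ∸ j) i     ≡⟨ pos-*/1 (n C j) ((n ∸ j) C i) ⟨
    + ((n C j) ℕ.* ((n ∸ j) C i)) / 1       ≡⟨ cong (λ x → + x / 1) (nCj*[n∸j]Ci≡nCi*[n∸i]Cj i≤n j≤n) ⟩
    + ((n C i) ℕ.* ((n ∸ i) C j)) / 1       ≡⟨ pos-*/1 (n C i) ((n ∸ i) C j) ⟩
    binomial n i ℚ.* binomial (n ∸ i) j     ∎
    where
    open ≡-Reasoning

  binomial-zero : ∀ {n k} → n < k → binomial n k ≡ 0ℚ
  binomial-zero n<k = cong (λ x → + x / 1) (k>n⇒nCk≡0 n<k)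

open BinomialCoefficients

module SumProperties {c ℓ} (R : CommutativeRing c ℓ) where

  open CommutativeRing R
  open Sum semiring
  open SetoidReasoning setoid

  sum-last : ∀ n (f : ℕ → Carrier) →
    ∑[ i ≤ n ] f (toℕ i) ≈ ∑[ i < n ] f (toℕ i) + f n
  sum-last zero    f = +-comm (f 0) 0#
  sum-last (suc n) f = begin
    f 0 + ∑[ i ≤ n ] f (suc (toℕ i))                ≈⟨ +-congˡ (sum-last n (λ i → f (suc i))) ⟩
    f 0 + (∑[ i < n ] f (suc (toℕ i)) + f (suc n))  ≈⟨ +-assoc _ _ _ ⟨
    f 0 + ∑[ i < n ] f (suc (toℕ i)) + f (suc n)    ∎

  sum-zero : ∀ {n} {f : Fin n → Carrier} → (∀ i → f i ≈ 0#) → sum f ≈ 0#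
  sum-zero {n} f≈0 = trans (sum-cong-≋ {n} f≈0) (sum-replicate-zero n)

  sum-truncate : ∀ {m n} {f : ℕ → Carrier} → m ≤ n → (∀ i → m ≤ i → f i ≈ 0#) →
    ∑[ i < n ] f (toℕ i) ≈ ∑[ i < m ] f (toℕ i)
  sum-truncate {n = n} z≤n f≈0 = sum-zero {n} λ i → f≈0 (toℕ i) z≤n
  sum-truncate (s≤s m≤n)   f≈0 = +-congˡ (sum-truncate m≤n λ i m≤i → f≈0 (suc i) (s≤s m≤i))

  sum-reverse : ∀ n (f : ℕ → Carrier) → ∑[ i ≤ n ] f (toℕ i) ≈ ∑[ i ≤ n ] f (n ∸ toℕ i)
  sum-reverse n f = begin
    ∑[ i ≤ n ] f (toℕ i)             ≈⟨ sum-permute {n = suc n} (λ i → f (toℕ i)) reverse ⟩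
    ∑[ i ≤ n ] f (toℕ (opposite i))  ≡⟨ sum-cong-≗ {suc n} (λ i → ≡.cong f (opposite-prop i)) ⟩
    ∑[ i ≤ n ] f (n ∸ toℕ i)         ∎

binomialTransform : (ℕ → ℚ) → ℕ → ℚ
binomialTransform b n = ℚ-Sum.sum {suc n} λ j → binomial n (toℕ j) ℚ.* b (toℕ j)

module Appell {c ℓ} (A : CommutativeRing c ℓ) (ι : ℚ → CommutativeRing.Carrier A)
  (isℚAlgebra : MultipleZeta.IsℚAlgebra A ι) where

  open CommutativeRing A
  open Exp semiring
  open Sum semiring
  open SumProperties A
  open SetoidReasoning setoid
  open RingMorphisms ℚ.+-*-rawRing rawRing
  open IsRingHomomorphism isℚAlgebra public
    using (+-homo; *-homo; -‿homo; 0#-homo; 1#-homo)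

  open SemiringSolver commutativeSemiring using (solve; _:=_; _:+_; _:*_)

  ι-cong : ∀ {p q} → p ≡ q → ι p ≈ ι q
  ι-cong p≡q = reflexive (≡.cong ι p≡q)

  ι-sum : ∀ {n} (f : Fin n → ℚ) → ι (ℚ-Sum.sum f) ≈ ∑[ i < n ] ι (f i)
  ι-sum {zero}  f = 0#-homo
  ι-sum {suc n} f = trans (+-homo _ _) (+-congˡ (ι-sum (λ i → f (Fin.suc i))))

  [z+1]^m≈∑ : ∀ {m N} z → m < N →
    (z + 1#) ^ m ≈ ∑[ i < N ] (ι (binomial m (toℕ i)) * z ^ toℕ i)
  [z+1]^m≈∑ {zero} {suc N} z _ = sym (begin
    ι 1ℚ * 1# + ∑[ i < N ] (ι 0ℚ * z ^ suc (toℕ i))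
      ≈⟨ +-cong (*-identityʳ _) (sum-zero {N} λ i → trans (*-congʳ 0#-homo) (zeroˡ _)) ⟩
    ι 1ℚ + 0# ≈⟨ +-identityʳ _ ⟩
    ι 1ℚ      ≈⟨ 1#-homo ⟩
    1#        ∎)
  [z+1]^m≈∑ {suc m} {suc N} z (s≤s m<N) = begin
    (z + 1#) * (z + 1#) ^ m
      ≈⟨ distribʳ _ z 1# ⟩
    z * (z + 1#) ^ m + 1# * (z + 1#) ^ m
      ≈⟨ +-cong (*-congˡ ([z+1]^m≈∑ z m<N)) (trans (*-identityˡ _) ([z+1]^m≈∑ z (ℕ.m<n⇒m<1+n m<N))) ⟩
    z * ∑[ i < N ] (d i * z ^ toℕ i) + (ι 1ℚ * 1# + ∑[ i < N ] (d′ i * z ^ suc (toℕ i)))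
      ≈⟨ +-congʳ (*-distribˡ-sum z λ i → d i * z ^ toℕ i) ⟩
    ∑[ i < N ] (z * (d i * z ^ toℕ i)) + (ι 1ℚ * 1# + ∑[ i < N ] (d′ i * z ^ suc (toℕ i)))
      ≈⟨ swap _ _ _ ⟩
    ι 1ℚ * 1# + (∑[ i < N ] (z * (d i * z ^ toℕ i)) + ∑[ i < N ] (d′ i * z ^ suc (toℕ i)))
      ≈⟨ +-congˡ (∑-distrib-+ (λ i → z * (d i * z ^ toℕ i)) (λ i → d′ i * z ^ suc (toℕ i))) ⟨
    ι 1ℚ * 1# + ∑[ i < N ] (z * (d i * z ^ toℕ i) + d′ i * z ^ suc (toℕ i))
      ≈⟨ +-congˡ (sum-cong-≋ {N} λ i → trans (collect z (d i) (d′ i) (z ^ toℕ i))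
           (*-congʳ (trans (sym (+-homo _ _)) (ι-cong (≡.sym (pascal m (toℕ i))))))) ⟩
    ι 1ℚ * 1# + ∑[ i < N ] (ι (binomial (suc m) (suc (toℕ i))) * z ^ suc (toℕ i))
      ∎
    where
    d d′ : Fin N → Carrier
    d i  = ι (binomial m (toℕ i))
    d′ i = ι (binomial m (suc (toℕ i)))
    swap : ∀ x y w → x + (y + w) ≈ y + (x + w)
    swap = solve 3 (λ x y w → (x :+ (y :+ w)) := (y :+ (x :+ w))) refl
    collect : ∀ z a b w → z * (a * w) + b * (z * w) ≈ (a + b) * (z * w)
    collect = solve 4 (λ z a b w → (z :* (a :* w) :+ b :* (z :* w)) := ((a :+ b) :* (z :* w))) refl

  appell : (ℕ → ℚ) → ℕ → Carrier → Carrier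
  appell b n z = ∑[ j ≤ n ] (ι (binomial n (toℕ j) ℚ.* b (toℕ j)) * z ^ (n ∸ toℕ j))

  appell-cong : ∀ {b b′} → (∀ j → b j ≡ b′ j) → ∀ n z → appell b n z ≈ appell b′ n z
  appell-cong b≡b′ n z = sum-cong-≋ {suc n} λ j →
    *-congʳ {z ^ (n ∸ toℕ j)} (ι-cong (≡.cong (binomial n (toℕ j) ℚ.*_) (b≡b′ (toℕ j))))

  -- The umbral identity (b + (z + 1))ⁿ = ((b + 1) + z)ⁿ.
  appell-shift : ∀ b n z → appell b n (z + 1#) ≈ appell (binomialTransform b) n z
  appell-shift b n z = begin
    ∑[ j ≤ n ] (ι (binomial n (toℕ j) ℚ.* b (toℕ j)) * (z + 1#) ^ (n ∸ toℕ j))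
      ≈⟨ sum-cong-≋ {suc n} (λ j → trans
           (*-congˡ {ι (binomial n (toℕ j) ℚ.* b (toℕ j))} ([z+1]^m≈∑ z (s≤s (ℕ.m∸n≤m n (toℕ j)))))
           (*-distribˡ-sum {suc n} _ (λ i → ι (binomial (n ∸ toℕ j) (toℕ i)) * z ^ toℕ i))) ⟩
    ∑[ j ≤ n ] ∑[ i ≤ n ]
      (ι (binomial n (toℕ j) ℚ.* b (toℕ j)) * (ι (binomial (n ∸ toℕ j) (toℕ i)) * z ^ toℕ i))
      ≈⟨ ∑-comm {suc n} {suc n} (λ j i →
           ι (binomial n (toℕ j) ℚ.* b (toℕ j)) * (ι (binomial (n ∸ toℕ j) (toℕ i)) * z ^ toℕ i)) ⟩
    ∑[ i ≤ n ] ∑[ j ≤ n ]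
      (ι (binomial n (toℕ j) ℚ.* b (toℕ j)) * (ι (binomial (n ∸ toℕ j) (toℕ i)) * z ^ toℕ i))
      ≈⟨ sum-cong-≋ {suc n} (λ i → sum-cong-≋ {suc n} (λ j →
           exchange (toℕ≤pred[n] i) (toℕ≤pred[n] j))) ⟩
    ∑[ i ≤ n ] ∑[ j ≤ n ]
      (ι (binomial n (toℕ i)) * z ^ toℕ i * ι (binomial (n ∸ toℕ i) (toℕ j) ℚ.* b (toℕ j)))
      ≈⟨ sum-cong-≋ {suc n} (λ i → *-distribˡ-sum {suc n} (ι (binomial n (toℕ i)) * z ^ toℕ i)
           (λ j → ι (binomial (n ∸ toℕ i) (toℕ j) ℚ.* b (toℕ j)))) ⟨
    ∑[ i ≤ n ] (ι (binomial n (toℕ i)) * z ^ toℕ i *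
      ∑[ j ≤ n ] ι (binomial (n ∸ toℕ i) (toℕ j) ℚ.* b (toℕ j)))
      ≈⟨ sum-cong-≋ {suc n} (λ i → trans
           (*-congˡ (transform (toℕ i)))
           (gather (binomial n (toℕ i)) (z ^ toℕ i) (b′ (n ∸ toℕ i)))) ⟩
    ∑[ i ≤ n ] (ι (binomial n (toℕ i) ℚ.* b′ (n ∸ toℕ i)) * z ^ toℕ i)
      ≈⟨ sum-reverse n (λ i → ι (binomial n i ℚ.* b′ (n ∸ i)) * z ^ i) ⟩
    ∑[ i ≤ n ] (ι (binomial n (n ∸ toℕ i) ℚ.* b′ (n ∸ (n ∸ toℕ i))) * z ^ (n ∸ toℕ i))
      ≈⟨ sum-cong-≋ {suc n} (λ i → *-congʳ {z ^ (n ∸ toℕ i)} (ι-cong (≡.cong₂ ℚ._*_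
           (≡.cong (λ x → + x / 1) (≡.sym (nCk≡nC[n∸k] (toℕ≤pred[n] i))))
           (≡.cong b′ (ℕ.m∸[m∸n]≡n (toℕ≤pred[n] i)))))) ⟩
    appell b′ n z
      ∎
    where
    b′ = binomialTransform b
    gather : ∀ p w q → ι p * w * ι q ≈ ι (p ℚ.* q) * w
    gather p w q = trans (move (ι p) w (ι q)) (*-congʳ (sym (*-homo p q)))
      where
      move : ∀ x w y → x * w * y ≈ x * y * w
      move = solve 3 (λ x w y → (x :* w :* y) := (x :* y :* w)) refl
    transform : ∀ i → ∑[ j ≤ n ] ι (binomial (n ∸ i) (toℕ j) ℚ.* b (toℕ j)) ≈ ι (b′ (n ∸ i))
    transform i = trans
      (sum-truncate {f = λ j → ι (binomial (n ∸ i) j ℚ.* b j)} (s≤s (ℕ.m∸n≤m n i)) λ j n∸i<j →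
        trans (ι-cong (≡.trans (≡.cong (ℚ._* b j) (binomial-zero n∸i<j)) (ℚ.*-zeroˡ (b j)))) 0#-homo)
      (sym (ι-sum {suc (n ∸ i)} (λ j → binomial (n ∸ i) (toℕ j) ℚ.* b (toℕ j))))
    exchange : ∀ {i j} → i ≤ n → j ≤ n →
      ι (binomial n j ℚ.* b j) * (ι (binomial (n ∸ j) i) * z ^ i) ≈
      ι (binomial n i) * z ^ i * ι (binomial (n ∸ i) j ℚ.* b j)
    exchange {i} {j} i≤n j≤n = begin
      ι (binomial n j ℚ.* b j) * (ι (binomial (n ∸ j) i) * z ^ i)
        ≈⟨ *-congʳ (*-homo _ _) ⟩
      ι (binomial n j) * ι (b j) * (ι (binomial (n ∸ j) i) * z ^ i)
        ≈⟨ move₁ _ _ _ _ ⟩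
      ι (binomial n j) * ι (binomial (n ∸ j) i) * (z ^ i * ι (b j))
        ≈⟨ *-congʳ (trans (sym (*-homo _ _)) (trans (ι-cong (binomial-swap i≤n j≤n)) (*-homo _ _))) ⟩
      ι (binomial n i) * ι (binomial (n ∸ i) j) * (z ^ i * ι (b j))
        ≈⟨ move₂ _ _ _ _ ⟩
      ι (binomial n i) * z ^ i * (ι (binomial (n ∸ i) j) * ι (b j))
        ≈⟨ *-congˡ (*-homo _ _) ⟨
      ι (binomial n i) * z ^ i * ι (binomial (n ∸ i) j ℚ.* b j)
        ∎
      where
      move₁ : ∀ a b c w → a * b * (c * w) ≈ a * c * (w * b)
      move₁ = solve 4 (λ a b c w → (a :* b :* (c :* w)) := (a :* c :* (w :* b))) refl
      move₂ : ∀ a c w b → a * c * (w * b) ≈ a * w * (c * b)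
      move₂ = solve 4 (λ a c w b → (a :* c :* (w :* b)) := (a :* w :* (c :* b))) refl

module BernoulliNumbers where

  open ≡
  open +-*-Solver using (solve; _:=_; _:+_; _:*_; :-_; con)

  ℚ-ring : CommutativeRing _ _
  ℚ-ring = ℚ.+-*-commutativeRing

  open Exp (CommutativeRing.semiring ℚ-ring) using () renaming (_^_ to _^ℚ_)
  module ℚ-SumProperties = SumProperties ℚ-ring
  module ℚ-Appell = Appell ℚ-ring id (Identity.isRingHomomorphism ℚ.+-*-rawRing refl)

  bernoulliAcc-irrelevant : ∀ {n} (a a′ : Acc _<_ n) → bernoulliAcc n a ≡ bernoulliAcc n a′
  bernoulliAcc-irrelevant {zero}  _        _         = refl
  bernoulliAcc-irrelevant {suc m} (acc rs) (acc rs′) =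
    cong (λ s → ℚ.- ((+ 1 / suc (suc m)) ℚ.* s))
      (ℚ-Sum.sum-cong-≗ {suc m} λ j → cong (binomial (suc (suc m)) (toℕ j) ℚ.*_)
        (bernoulliAcc-irrelevant (rs (toℕ<n j)) (rs′ (toℕ<n j))))

  bernoulli-suc : ∀ m → bernoulli (suc m) ≡
    ℚ.- ((+ 1 / suc (suc m)) ℚ.*
         ℚ-Sum.sum {suc m} λ j → binomial (suc (suc m)) (toℕ j) ℚ.* bernoulli (toℕ j))
  bernoulli-suc m = unfold (<-wellFounded (suc m))
    where
    unfold : (a : Acc _<_ (suc m)) → bernoulliAcc (suc m) a ≡
      ℚ.- ((+ 1 / suc (suc m)) ℚ.*
           ℚ-Sum.sum {suc m} λ j → binomial (suc (suc m)) (toℕ j) ℚ.* bernoulli (toℕ j))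
    unfold (acc rs) = cong (λ s → ℚ.- ((+ 1 / suc (suc m)) ℚ.* s))
      (ℚ-Sum.sum-cong-≗ {suc m} λ j → cong (binomial (suc (suc m)) (toℕ j) ℚ.*_)
        (bernoulliAcc-irrelevant (rs (toℕ<n j)) (<-wellFounded (toℕ j))))

  δ₁ : ℕ → ℚ
  δ₁ 1 = 1ℚ
  δ₁ _ = 0ℚ

  IsBernoulli : (ℕ → ℚ) → Set
  IsBernoulli b = ∀ n → binomialTransform b n ≡ b n ℚ.+ δ₁ n

  binomial-diagonal : ∀ n → binomial n n ≡ 1ℚ
  binomial-diagonal n = cong (λ x → + x / 1) (nCn≡1 n)

  binomialTransform-last : ∀ b n → binomialTransform b n ≡
    ℚ-Sum.sum {n} (λ j → binomial n (toℕ j) ℚ.* b (toℕ j)) ℚ.+ b n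
  binomialTransform-last b n = trans
    (ℚ-SumProperties.sum-last n (λ j → binomial n j ℚ.* b j))
    (cong (ℚ-Sum.sum {n} (λ j → binomial n (toℕ j) ℚ.* b (toℕ j)) ℚ.+_) (trans (cong (ℚ._* b n) (binomial-diagonal n)) (ℚ.*-identityˡ (b n))))

  bernoulli-isBernoulli : IsBernoulli bernoulli
  bernoulli-isBernoulli zero          = refl
  bernoulli-isBernoulli (suc zero)    = refl
  bernoulli-isBernoulli (suc (suc m)) = begin
    binomialTransform bernoulli n                     ≡⟨ binomialTransform-last bernoulli n ⟩
    ℚ-Sum.sum {suc m′} (λ j → f (toℕ j)) ℚ.+ bernoulli n ≡⟨ cong (ℚ._+ bernoulli n) (ℚ-SumProperties.sum-last m′ f) ⟩
    s ℚ.+ f m′ ℚ.+ bernoulli n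
      ≡⟨ cong₂ (λ c b → s ℚ.+ c ℚ.* b ℚ.+ bernoulli n) (cong (λ x → + x / 1) ([1+n]Cn≡1+n m′)) (bernoulli-suc m) ⟩
    s ℚ.+ (+ n / 1) ℚ.* ℚ.- ((+ 1 / n) ℚ.* s) ℚ.+ bernoulli n
      ≡⟨ solve 4 (λ s x y b → s :+ x :* :- (y :* s) :+ b := s :+ :- ((y :* x) :* s) :+ b) refl
           s (+ n / 1) (+ 1 / n) (bernoulli n) ⟩
    s ℚ.+ ℚ.- (((+ 1 / n) ℚ.* (+ n / 1)) ℚ.* s) ℚ.+ bernoulli n
      ≡⟨ cong (λ u → s ℚ.+ ℚ.- (u ℚ.* s) ℚ.+ bernoulli n) ([1/n]*n≡1 n) ⟩
    s ℚ.+ ℚ.- (1ℚ ℚ.* s) ℚ.+ bernoulli n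
      ≡⟨ solve 2 (λ s b → s :+ :- (con 1ℚ :* s) :+ b := b :+ con 0ℚ) refl s (bernoulli n) ⟩
    bernoulli n ℚ.+ 0ℚ                                ∎
    where
    open ≡-Reasoning
    m′ = suc m
    n  = suc m′
    f : ℕ → ℚ
    f j = binomial n j ℚ.* bernoulli j
    s = ℚ-Sum.sum {m′} (λ j → f (toℕ j))

  isBernoulli-unique : ∀ b b′ → IsBernoulli b → IsBernoulli b′ → ∀ n → b n ≡ b′ n
  isBernoulli-unique b b′ isB isB′ = <-rec (λ n → b n ≡ b′ n) step
    where
    open ≡-Reasoning
    lower : (ℕ → ℚ) → ℕ → ℚ
    lower c n = ℚ-Sum.sum {n} (λ j → binomial (suc n) (toℕ j) ℚ.* c (toℕ j))

    top : ∀ c → IsBernoulli c → ∀ n → c n ≡ (+ 1 / suc n) ℚ.* (δ₁ (suc n) ℚ.+ ℚ.- lower c n)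
    top c isC n = begin
      c n                              ≡⟨ ℚ.*-identityˡ (c n) ⟨
      1ℚ ℚ.* c n                       ≡⟨ cong (ℚ._* c n) ([1/n]*n≡1 (suc n)) ⟨
      (+ 1 / suc n) ℚ.* (+ suc n / 1) ℚ.* c n
        ≡⟨ solve 5 (λ u v x s y → u :* v :* x := u :* ((s :+ v :* x :+ y) :+ :- (s :+ y))) refl
             (+ 1 / suc n) (+ suc n / 1) (c n) (lower c n) (c (suc n)) ⟩
      (+ 1 / suc n) ℚ.* ((lower c n ℚ.+ (+ suc n / 1) ℚ.* c n ℚ.+ c (suc n)) ℚ.+ ℚ.- (lower c n ℚ.+ c (suc n)))
        ≡⟨ cong (λ t → (+ 1 / suc n) ℚ.* (t ℚ.+ ℚ.- (lower c n ℚ.+ c (suc n)))) (trans (sym expand) (isC (suc n))) ⟩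
      (+ 1 / suc n) ℚ.* ((c (suc n) ℚ.+ δ₁ (suc n)) ℚ.+ ℚ.- (lower c n ℚ.+ c (suc n)))
        ≡⟨ solve 4 (λ u y d s → u :* ((y :+ d) :+ :- (s :+ y)) := u :* (d :+ :- s)) refl
             (+ 1 / suc n) (c (suc n)) (δ₁ (suc n)) (lower c n) ⟩
      (+ 1 / suc n) ℚ.* (δ₁ (suc n) ℚ.+ ℚ.- lower c n) ∎
      where
      expand : binomialTransform c (suc n) ≡ lower c n ℚ.+ (+ suc n / 1) ℚ.* c n ℚ.+ c (suc n)
      expand = trans (binomialTransform-last c (suc n)) (cong (ℚ._+ c (suc n)) (trans
        (ℚ-SumProperties.sum-last n (λ j → binomial (suc n) j ℚ.* c j))
        (cong (λ x → lower c n ℚ.+ (+ x / 1) ℚ.* c n) ([1+n]Cn≡1+n n))))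

    step : ∀ n → (∀ {m} → m < n → b m ≡ b′ m) → b n ≡ b′ n
    step n ih = begin
      b n                                                ≡⟨ top b isB n ⟩
      (+ 1 / suc n) ℚ.* (δ₁ (suc n) ℚ.+ ℚ.- lower b n)   ≡⟨ cong (λ s → (+ 1 / suc n) ℚ.* (δ₁ (suc n) ℚ.+ ℚ.- s))
        (ℚ-Sum.sum-cong-≗ {n} λ j → cong (binomial (suc n) (toℕ j) ℚ.*_) (ih (toℕ<n j))) ⟩
      (+ 1 / suc n) ℚ.* (δ₁ (suc n) ℚ.+ ℚ.- lower b′ n)  ≡⟨ top b′ isB′ n ⟨
      b′ n                                               ∎

  -1^_ : ℕ → ℚ
  -1^ n = (ℚ.- 1ℚ) ^ℚ n

  -1^n*-1^n≡1 : ∀ n → -1^ n ℚ.* -1^ n ≡ 1ℚ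
  -1^n*-1^n≡1 zero    = refl
  -1^n*-1^n≡1 (suc n) = trans
    (solve 1 (λ x → (con (ℚ.- 1ℚ) :* x) :* (con (ℚ.- 1ℚ) :* x) := x :* x) refl (-1^ n))
    (-1^n*-1^n≡1 n)

  -1^n*-1^[n∸j]≡-1^j : ∀ {j n} → j ≤ n → -1^ n ℚ.* -1^ (n ∸ j) ≡ -1^ j
  -1^n*-1^[n∸j]≡-1^j {n = n} z≤n = -1^n*-1^n≡1 n
  -1^n*-1^[n∸j]≡-1^j {suc j} {suc n} (s≤s j≤n) = trans
    (ℚ.*-assoc (ℚ.- 1ℚ) (-1^ n) (-1^ (n ∸ j)))
    (cong (ℚ.- 1ℚ ℚ.*_) (-1^n*-1^[n∸j]≡-1^j j≤n))

  appell-0 : ∀ b n → ℚ-Appell.appell b n 0ℚ ≡ b n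
  appell-0 b n = begin
    ℚ-Appell.appell b n 0ℚ
      ≡⟨ ℚ-SumProperties.sum-last n (λ j → binomial n j ℚ.* b j ℚ.* 0ℚ ^ℚ (n ∸ j)) ⟩
    ℚ-Sum.sum {n} (λ j → binomial n (toℕ j) ℚ.* b (toℕ j) ℚ.* 0ℚ ^ℚ (n ∸ toℕ j))
      ℚ.+ binomial n n ℚ.* b n ℚ.* 0ℚ ^ℚ (n ∸ n)
      ≡⟨ cong₂ ℚ._+_
           (ℚ-SumProperties.sum-zero {n} λ j → trans
             (cong (binomial n (toℕ j) ℚ.* b (toℕ j) ℚ.*_) (0^[n∸j]≡0 (toℕ<n j)))
             (ℚ.*-zeroʳ (binomial n (toℕ j) ℚ.* b (toℕ j))))
           (cong₂ (λ c k → c ℚ.* b n ℚ.* 0ℚ ^ℚ k) (binomial-diagonal n) (ℕ.n∸n≡0 n)) ⟩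
    0ℚ ℚ.+ 1ℚ ℚ.* b n ℚ.* 1ℚ
      ≡⟨ solve 1 (λ x → con 0ℚ :+ con 1ℚ :* x :* con 1ℚ := x) refl (b n) ⟩
    b n ∎
    where
    open ≡-Reasoning
    0^[n∸j]≡0 : ∀ {j n} → j < n → 0ℚ ^ℚ (n ∸ j) ≡ 0ℚ
    0^[n∸j]≡0 {j} {suc n} (s≤s j≤n) rewrite ℕ.+-∸-assoc 1 j≤n = ℚ.*-zeroˡ (0ℚ ^ℚ (n ∸ j))

  -- Bₙ = Bₙ(-1 + 1), expanded at -1, says that (-1)ʲ(Bⱼ + δ₁ j) also satisfies the
  -- recurrence that determines the Bernoulli numbers.
  bernoulli-reflection : ∀ n → binomialTransform bernoulli n ≡ -1^ n ℚ.* bernoulli n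
  bernoulli-reflection n = begin
    bernoulli⁺ n                            ≡⟨ ℚ.*-identityˡ _ ⟨
    1ℚ ℚ.* bernoulli⁺ n                     ≡⟨ cong (ℚ._* bernoulli⁺ n) (-1^n*-1^n≡1 n) ⟨
    -1^ n ℚ.* -1^ n ℚ.* bernoulli⁺ n        ≡⟨ ℚ.*-assoc (-1^ n) (-1^ n) (bernoulli⁺ n) ⟩
    -1^ n ℚ.* reflected n                   ≡⟨ cong (-1^ n ℚ.*_) (isBernoulli-unique reflected bernoulli isB bernoulli-isBernoulli n) ⟩
    -1^ n ℚ.* bernoulli n                   ∎
    where
    open ≡-Reasoning
    bernoulli⁺ reflected : ℕ → ℚ
    bernoulli⁺ = binomialTransform bernoulli
    reflected j = -1^ j ℚ.* bernoulli⁺ j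

    cancel : ∀ n b → -1^ n ℚ.* b ≡ -1^ n ℚ.* (b ℚ.+ δ₁ n) ℚ.+ δ₁ n
    cancel 0 = solve 1 (λ b → con 1ℚ :* b := con 1ℚ :* (b :+ con 0ℚ) :+ con 0ℚ) refl
    cancel 1 = solve 1 (λ b → con (ℚ.- 1ℚ) :* b := con (ℚ.- 1ℚ) :* (b :+ con 1ℚ) :+ con 1ℚ) refl
    cancel n@(suc (suc _)) = solve 2 (λ s b → s :* b := s :* (b :+ con 0ℚ) :+ con 0ℚ) refl (-1^ n)

    isB : IsBernoulli reflected
    isB n = begin
      binomialTransform reflected n
        ≡⟨ ℚ-Sum.sum-cong-≗ {suc n} (λ j → trans
             (cong (λ s → binomial n (toℕ j) ℚ.* (s ℚ.* bernoulli⁺ (toℕ j)))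
               (sym (-1^n*-1^[n∸j]≡-1^j (toℕ≤pred[n] j))))
             (solve 4 (λ c s t b → c :* ((s :* t) :* b) := s :* ((c :* b) :* t)) refl
               (binomial n (toℕ j)) (-1^ n) (-1^ (n ∸ toℕ j)) (bernoulli⁺ (toℕ j)))) ⟩
      ℚ-Sum.sum {suc n} (λ j → -1^ n ℚ.* (binomial n (toℕ j) ℚ.* bernoulli⁺ (toℕ j) ℚ.* -1^ (n ∸ toℕ j)))
        ≡⟨ ℚ-Sum.*-distribˡ-sum {suc n} (-1^ n)
             (λ j → binomial n (toℕ j) ℚ.* bernoulli⁺ (toℕ j) ℚ.* -1^ (n ∸ toℕ j)) ⟨
      -1^ n ℚ.* ℚ-Appell.appell bernoulli⁺ n (ℚ.- 1ℚ)
        ≡⟨ cong (-1^ n ℚ.*_) (ℚ-Appell.appell-shift bernoulli n (ℚ.- 1ℚ)) ⟨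
      -1^ n ℚ.* ℚ-Appell.appell bernoulli n 0ℚ
        ≡⟨ cong (-1^ n ℚ.*_) (appell-0 bernoulli n) ⟩
      -1^ n ℚ.* bernoulli n
        ≡⟨ cancel n (bernoulli n) ⟩
      -1^ n ℚ.* (bernoulli n ℚ.+ δ₁ n) ℚ.+ δ₁ n
        ≡⟨ cong (λ b → -1^ n ℚ.* b ℚ.+ δ₁ n) (bernoulli-isBernoulli n) ⟨
      reflected n ℚ.+ δ₁ n
        ∎

  pochhammer-binomial : ∀ {k q} → q ≤ k →
    (pochhammer (ℤ.- + k) q / 1) ℚ.* (+ suc k / 1) ≡
    -1^ q ℚ.* ((+ (suc q !) / 1) ℚ.* binomial (suc k) (suc q))
  pochhammer-binomial {k} {zero} _ = begin
    1ℚ ℚ.* (+ suc k / 1)                       ≡⟨ cong (λ x → 1ℚ ℚ.* (+ x / 1)) (nC1≡n (suc k)) ⟨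
    1ℚ ℚ.* binomial (suc k) 1                  ≡⟨ cong (1ℚ ℚ.*_) (ℚ.*-identityˡ (binomial (suc k) 1)) ⟨
    1ℚ ℚ.* (1ℚ ℚ.* binomial (suc k) 1)         ∎
    where open ≡-Reasoning
  pochhammer-binomial {k} {suc q} q<k = begin
    (pochhammer (ℤ.- + k) q ℤ.* (ℤ.- + k ℤ.+ + q) / 1) ℚ.* k₁
      ≡⟨ cong (ℚ._* k₁) (trans (/1-homo-* (pochhammer (ℤ.- + k) q) (ℤ.- + k ℤ.+ + q)) (cong (p ℚ.*_) -k+q)) ⟩
    p ℚ.* (ℚ.- 1ℚ ℚ.* d) ℚ.* k₁
      ≡⟨ solve 3 (λ p d k → p :* (con (ℚ.- 1ℚ) :* d) :* k := (p :* k) :* (con (ℚ.- 1ℚ) :* d)) refl p d k₁ ⟩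
    (p ℚ.* k₁) ℚ.* (ℚ.- 1ℚ ℚ.* d)
      ≡⟨ cong (ℚ._* (ℚ.- 1ℚ ℚ.* d)) (pochhammer-binomial (ℕ.<⇒≤ q<k)) ⟩
    -1^ q ℚ.* (f ℚ.* c) ℚ.* (ℚ.- 1ℚ ℚ.* d)
      ≡⟨ solve 4 (λ s f c d → s :* (f :* c) :* (con (ℚ.- 1ℚ) :* d) := con (ℚ.- 1ℚ) :* s :* (f :* (d :* c))) refl (-1^ q) f c d ⟩
    -1^ suc q ℚ.* (f ℚ.* (d ℚ.* c))
      ≡⟨ cong (λ x → -1^ suc q ℚ.* (f ℚ.* x)) (trans (sym (pos-*/1 (k ∸ q) (suc k C suc q)))
           (trans (cong (λ x → + x / 1) (sym ([1+k]*nC[1+k]≡[n∸k]*nCk (suc k) (suc q))))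
             (pos-*/1 (suc (suc q)) (suc k C suc (suc q))))) ⟩
    -1^ suc q ℚ.* (f ℚ.* ((+ suc (suc q) / 1) ℚ.* c′))
      ≡⟨ cong (-1^ suc q ℚ.*_) (solve 3 (λ f x c → f :* (x :* c) := (x :* f) :* c) refl f (+ suc (suc q) / 1) c′) ⟩
    -1^ suc q ℚ.* ((+ suc (suc q) / 1) ℚ.* f ℚ.* c′)
      ≡⟨ cong (λ x → -1^ suc q ℚ.* (x ℚ.* c′)) (pos-*/1 (suc (suc q)) (suc q !)) ⟨
    -1^ suc q ℚ.* ((+ (suc (suc q) !) / 1) ℚ.* c′)
      ∎
    where
    open ≡-Reasoning
    p  = pochhammer (ℤ.- + k) q / 1
    k₁ = + suc k / 1
    d  = + (k ∸ q) / 1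
    f  = + (suc q !) / 1
    c  = binomial (suc k) (suc q)
    c′ = binomial (suc k) (suc (suc q))
    -k+q : (ℤ.- + k ℤ.+ + q) / 1 ≡ ℚ.- 1ℚ ℚ.* d
    -k+q = trans (cong (_/ 1) -k+q≡-1*[k∸q]) (/1-homo-* (ℤ.- + 1) (+ (k ∸ q)))
      where
      -k+q≡-1*[k∸q] : ℤ.- + k ℤ.+ + q ≡ ℤ.- + 1 ℤ.* + (k ∸ q)
      -k+q≡-1*[k∸q] = begin
        ℤ.- + k ℤ.+ + q         ≡⟨ ℤ.+-comm (ℤ.- + k) (+ q) ⟩
        + q ℤ.- + k             ≡⟨ ℤ.m-n≡m⊖n q k ⟩
        q ℤ.⊖ k                 ≡⟨ ℤ.⊖-≤ (ℕ.<⇒≤ q<k) ⟩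
        ℤ.- + (k ∸ q)           ≡⟨ ℤ.-1*i≡-i (+ (k ∸ q)) ⟨
        ℤ.- + 1 ℤ.* + (k ∸ q)   ∎

  coefficient-binomial : ∀ {k q} → q ≤ k →
    ℚ.- ((+ 1 / suc k) ℚ.* (binomial (suc k) (suc q) ℚ.* binomialTransform bernoulli (suc q))) ≡
    coefficient k q
  coefficient-binomial {k} {q} q≤k = begin
    ℚ.- (u ℚ.* (c ℚ.* binomialTransform bernoulli (suc q)))
      ≡⟨ cong (λ b → ℚ.- (u ℚ.* (c ℚ.* b))) (bernoulli-reflection (suc q)) ⟩
    ℚ.- (u ℚ.* (c ℚ.* (ℚ.- 1ℚ ℚ.* s ℚ.* b)))
      ≡⟨ solve 4 (λ u c s b → :- (u :* (c :* (con (ℚ.- 1ℚ) :* s :* b))) := con 1ℚ :* (u :* (c :* (s :* b)))) refl u c s b ⟩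
    1ℚ ℚ.* (u ℚ.* (c ℚ.* (s ℚ.* b)))
      ≡⟨ cong (ℚ._* (u ℚ.* (c ℚ.* (s ℚ.* b)))) ([1/n]*n≡1 (suc q !)) ⟨
    v ℚ.* f ℚ.* (u ℚ.* (c ℚ.* (s ℚ.* b)))
      ≡⟨ solve 6 (λ v f u c s b → v :* f :* (u :* (c :* (s :* b))) := (s :* (f :* c)) :* (u :* b :* v)) refl v f u c s b ⟩
    s ℚ.* (f ℚ.* c) ℚ.* (u ℚ.* b ℚ.* v)
      ≡⟨ cong (ℚ._* (u ℚ.* b ℚ.* v)) (pochhammer-binomial q≤k) ⟨
    p ℚ.* k₁ ℚ.* (u ℚ.* b ℚ.* v)
      ≡⟨ solve 5 (λ p k u b v → p :* k :* (u :* b :* v) := (u :* k) :* (p :* b :* v)) refl p k₁ u b v ⟩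
    (u ℚ.* k₁) ℚ.* (p ℚ.* b ℚ.* v)
      ≡⟨ cong (ℚ._* (p ℚ.* b ℚ.* v)) ([1/n]*n≡1 (suc k)) ⟩
    1ℚ ℚ.* (p ℚ.* b ℚ.* v)
      ≡⟨ ℚ.*-identityˡ (p ℚ.* b ℚ.* v) ⟩
    coefficient k q ∎
    where
    open ≡-Reasoning
    instance _ = suc q ℕ.!≢0
    u  = + 1 / suc k
    k₁ = + suc k / 1
    v  = + 1 / (suc q !)
    f  = + (suc q !) / 1
    p  = pochhammer (ℤ.- + k) q / 1
    c  = binomial (suc k) (suc q)
    s  = -1^ q
    b  = bernoulli (suc q)

open BernoulliNumbers

module DifferenceEquations {c ℓ} (A : CommutativeRing c ℓ) (ι : ℚ → CommutativeRing.Carrier A)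
  (isℚAlgebra : MultipleZeta.IsℚAlgebra A ι) where

  open CommutativeRing A
  open MultipleZeta A ι
  open Exp semiring
  open Sum semiring
  open SumProperties A
  open Appell A ι isℚAlgebra
  open SetoidReasoning setoid
  open SemiringSolver commutativeSemiring using (solve; _:=_; _:+_; _:*_)
  open RingProperties ring using (-‿distribˡ-*; -‿distribʳ-*)
  open AbelianGroupProperties +-abelianGroup using (xyx⁻¹≈y; ⁻¹-∙-comm)

  recursion : ∀ k → (x y : Carrier) → (Fin k → Carrier) → Carrier
  recursion k x y f =
    - (ι (+ 1 / suc k) * x) - ι ½ * y + ∑[ i < k ] (ι (coefficient k (suc (toℕ i))) * f i)

  recursion-cong : ∀ k {x x′ y y′ f f′} → x ≈ x′ → y ≈ y′ → (∀ i → f i ≈ f′ i) →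
    recursion k x y f ≈ recursion k x′ y′ f′
  recursion-cong k x≈x′ y≈y′ f≈f′ = +-cong
    (+-cong (-‿cong (*-congˡ x≈x′)) (-‿cong (*-congˡ y≈y′)))
    (sum-cong-≋ {k} λ i → *-congˡ (f≈f′ i))

  recursion-linear : ∀ k w x u y v (f g : Fin k → Carrier) →
    recursion k (x + w * u) (y + w * v) (λ i → f i + w * g i) ≈
    recursion k x y f + w * recursion k u v g
  recursion-linear k w x u y v f g = begin
    recursion k (x + w * u) (y + w * v) (λ i → f i + w * g i)
      ≈⟨ +-cong (+-cong (-‿distribˡ-* a (x + w * u)) (-‿distribˡ-* b (y + w * v))) sum-linear ⟩
    - a * (x + w * u) + - b * (y + w * v) + (F + w * G)
      ≈⟨ solve 9 (λ a b w x u y v F G →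
           a :* (x :+ w :* u) :+ b :* (y :+ w :* v) :+ (F :+ w :* G) :=
           (a :* x :+ b :* y :+ F) :+ w :* (a :* u :+ b :* v :+ G)) refl
           (- a) (- b) w x u y v F G ⟩
    (- a * x + - b * y + F) + w * (- a * u + - b * v + G)
      ≈⟨ +-cong
           (+-congʳ (+-cong (-‿distribˡ-* a x) (-‿distribˡ-* b y)))
           (*-congˡ (+-congʳ (+-cong (-‿distribˡ-* a u) (-‿distribˡ-* b v)))) ⟨
    recursion k x y f + w * recursion k u v g
      ∎
    where
    a = ι (+ 1 / suc k)
    b = ι ½
    d : Fin k → Carrier
    d i = ι (coefficient k (suc (toℕ i)))
    F = ∑[ i < k ] (d i * f i)
    G = ∑[ i < k ] (d i * g i)
    sum-linear : ∑[ i < k ] (d i * (f i + w * g i)) ≈ F + w * G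
    sum-linear = begin
      ∑[ i < k ] (d i * (f i + w * g i))
        ≈⟨ sum-cong-≋ {k} (λ i → solve 4 (λ d f w g →
             d :* (f :+ w :* g) := d :* f :+ w :* (d :* g)) refl (d i) (f i) w (g i)) ⟩
      ∑[ i < k ] (d i * f i + w * (d i * g i))
        ≈⟨ ∑-distrib-+ (λ i → d i * f i) (λ i → w * (d i * g i)) ⟩
      F + ∑[ i < k ] (w * (d i * g i))
        ≈⟨ +-congˡ (*-distribˡ-sum w (λ i → d i * g i)) ⟨
      F + w * G ∎

  bernoulliPoly-difference : ∀ k z →
    bernoulliPoly (suc k) (z + 1#) ≈ bernoulliPoly (suc k) z + ι (+ suc k / 1) * z ^ k
  bernoulliPoly-difference k z = begin
    appell bernoulli n (z + 1#)
      ≈⟨ appell-shift bernoulli n z ⟩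
    appell (binomialTransform bernoulli) n z
      ≈⟨ appell-cong bernoulli-isBernoulli n z ⟩
    appell (λ j → bernoulli j ℚ.+ δ₁ j) n z
      ≈⟨ sum-cong-≋ {suc n} (λ j → trans
           (*-congʳ {z ^ (n ∸ toℕ j)} (trans
             (ι-cong (ℚ.*-distribˡ-+ (binomial n (toℕ j)) (bernoulli (toℕ j)) (δ₁ (toℕ j))))
             (+-homo (binomial n (toℕ j) ℚ.* bernoulli (toℕ j)) (binomial n (toℕ j) ℚ.* δ₁ (toℕ j)))))
           (distribʳ (z ^ (n ∸ toℕ j)) _ _)) ⟩
    ∑[ j ≤ n ] (term bernoulli (toℕ j) + term δ₁ (toℕ j))
      ≈⟨ ∑-distrib-+ {suc n} (λ j → term bernoulli (toℕ j)) (λ j → term δ₁ (toℕ j)) ⟩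
    bernoulliPoly n z + appell δ₁ n z
      ≈⟨ +-congˡ appell-δ₁ ⟩
    bernoulliPoly n z + ι (+ n / 1) * z ^ k
      ∎
    where
    n = suc k
    term : (ℕ → ℚ) → ℕ → Carrier
    term b j = ι (binomial n j ℚ.* b j) * z ^ (n ∸ j)
    vanish : ∀ p w → ι (p ℚ.* 0ℚ) * w ≈ 0#
    vanish p w = trans (*-congʳ (trans (ι-cong (ℚ.*-zeroʳ p)) 0#-homo)) (zeroˡ w)
    appell-δ₁ : appell δ₁ n z ≈ ι (+ n / 1) * z ^ k
    appell-δ₁ = begin
      term δ₁ 0 + (term δ₁ 1 + ∑[ i < k ] term δ₁ (suc (suc (toℕ i))))
        ≈⟨ +-cong (vanish (binomial n 0) (z ^ n)) (+-cong
             (*-congʳ (ι-cong (≡.trans (ℚ.*-identityʳ (binomial n 1)) (≡.cong (λ x → + x / 1) (nC1≡n n)))))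
             (sum-zero {k} λ i → vanish (binomial n (suc (suc (toℕ i)))) (z ^ (n ∸ suc (suc (toℕ i)))))) ⟩
      0# + (ι (+ n / 1) * z ^ k + 0#)
        ≈⟨ trans (+-identityˡ _) (+-identityʳ _) ⟩
      ι (+ n / 1) * z ^ k ∎

  ζ₁-shift : ∀ m z →
    ζ (m ∷ []) (z + 1#) ≈ recursion m (z ^ suc m) (z ^ m) (λ i → z ^ (m ∸ suc (toℕ i)))
  ζ₁-shift m z = begin
    - (ι K * appell bernoulli (suc m) (z + 1#))
      ≈⟨ -‿cong (*-congˡ (appell-shift bernoulli (suc m) z)) ⟩
    - (ι K * (term 0 + (term 1 + ∑[ i < m ] term (suc (suc (toℕ i))))))
      ≈⟨ -‿distribˡ-* _ _ ⟩
    - ι K * (term 0 + (term 1 + ∑[ i < m ] term (suc (suc (toℕ i)))))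
      ≈⟨ solve 4 (λ u t₀ t₁ s → u :* (t₀ :+ (t₁ :+ s)) := u :* t₀ :+ u :* t₁ :+ u :* s) refl _ _ _ _ ⟩
    - ι K * term 0 + - ι K * term 1 + - ι K * ∑[ i < m ] term (suc (suc (toℕ i)))
      ≈⟨ +-cong
           (+-cong (merge 0 (ι-cong term₀)) (merge 1 (ι-cong term₁)))
           (*-distribˡ-sum {m} (- ι K) (λ i → term (suc (suc (toℕ i))))) ⟩
    ι (ℚ.- K) * z ^ suc m + ι (ℚ.- ½) * z ^ m + ∑[ i < m ] (- ι K * term (suc (suc (toℕ i))))
      ≈⟨ +-cong
           (+-cong (negate K (z ^ suc m)) (negate ½ (z ^ m)))
           (sum-cong-≋ {m} λ i → merge (suc (suc (toℕ i))) (ι-cong (coefficient-binomial (toℕ<n i)))) ⟩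
    recursion m (z ^ suc m) (z ^ m) (λ i → z ^ (m ∸ suc (toℕ i)))
      ∎
    where
    K = + 1 / suc m
    c⁺ : ℕ → ℚ
    c⁺ j = binomial (suc m) j ℚ.* binomialTransform bernoulli j
    term : ℕ → Carrier
    term j = ι (c⁺ j) * z ^ (suc m ∸ j)
    negate : ∀ p w → ι (ℚ.- p) * w ≈ - (ι p * w)
    negate p w = trans (*-congʳ (-‿homo p)) (sym (-‿distribˡ-* (ι p) w))
    merge : ∀ j {x} → ι (ℚ.- (K ℚ.* c⁺ j)) ≈ x → - ι K * term j ≈ x * z ^ (suc m ∸ j)
    merge j {x} eq = begin
      - ι K * (ι (c⁺ j) * z ^ (suc m ∸ j))   ≈⟨ *-assoc _ _ _ ⟨
      - ι K * ι (c⁺ j) * z ^ (suc m ∸ j)     ≈⟨ *-congʳ (-‿distribˡ-* _ _) ⟨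
      - (ι K * ι (c⁺ j)) * z ^ (suc m ∸ j)   ≈⟨ *-congʳ (trans (-‿homo _) (-‿cong (*-homo K (c⁺ j)))) ⟨
      ι (ℚ.- (K ℚ.* c⁺ j)) * z ^ (suc m ∸ j) ≈⟨ *-congʳ eq ⟩
      x * z ^ (suc m ∸ j)                    ∎
    term₀ : ℚ.- (K ℚ.* c⁺ 0) ≡ ℚ.- K
    term₀ = ≡.cong ℚ.-_ (ℚ.*-identityʳ K)
    term₁ : ℚ.- (K ℚ.* c⁺ 1) ≡ ℚ.- ½
    term₁ = ≡.cong ℚ.-_ (≡.trans
      (≡.cong (λ x → K ℚ.* ((+ x / 1) ℚ.* ½)) (nC1≡n (suc m)))
      (≡.trans (≡.sym (ℚ.*-assoc K (+ suc m / 1) ½))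
        (≡.trans (≡.cong (ℚ._* ½) ([1/n]*n≡1 (suc m))) (ℚ.*-identityˡ ½))))

  -- The difference equation with V(z) moved to the right, so that it is
  -- visibly linear.
  ζ-shift : ∀ {r} k (ks : Vec ℕ r) z →
    ζ (k ∷ ks) (z + 1#) ≈ ζ (k ∷ ks) z + - (z ^ k) * ζ ks (z + 1#)
  ζ-shift {zero} k [] z = begin
    - (ι K * bernoulliPoly (suc k) (z + 1#))
      ≈⟨ -‿cong (*-congˡ (bernoulliPoly-difference k z)) ⟩
    - (ι K * (bernoulliPoly (suc k) z + ι (+ suc k / 1) * z ^ k))
      ≈⟨ -‿cong (trans (distribˡ _ _ _) (+-congˡ (sym (*-assoc _ _ _)))) ⟩
    - (ι K * bernoulliPoly (suc k) z + ι K * ι (+ suc k / 1) * z ^ k)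
      ≈⟨ ⁻¹-∙-comm _ _ ⟨
    - (ι K * bernoulliPoly (suc k) z) + - (ι K * ι (+ suc k / 1) * z ^ k)
      ≈⟨ +-congˡ (-‿cong (trans
           (*-congʳ (trans (sym (*-homo _ _)) (trans (ι-cong ([1/n]*n≡1 (suc k))) 1#-homo)))
           (*-identityˡ _))) ⟩
    - (ι K * bernoulliPoly (suc k) z) + - (z ^ k)
      ≈⟨ +-congˡ (*-identityʳ _) ⟨
    - (ι K * bernoulliPoly (suc k) z) + - (z ^ k) * 1#
      ∎
    where K = + 1 / suc k
  ζ-shift {suc zero} k (m ∷ []) z = begin
    ζ (k ∷ m ∷ []) (z + 1#)
      ≈⟨ recursion-cong m
           (shift₁ (k ℕ.+ m ℕ.+ 1) (suc m) (≡.trans (ℕ.+-comm (k ℕ.+ m) 1) (≡.sym (ℕ.+-suc k m))))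
           (shift₁ (k ℕ.+ m) m ≡.refl)
           (λ i → shift₁ (k ℕ.+ m ∸ suc (toℕ i)) (m ∸ suc (toℕ i)) (ℕ.+-∸-assoc k (toℕ<n i))) ⟩
    recursion m _ _ _
      ≈⟨ recursion-linear m (- (z ^ k)) _ (z ^ suc m) _ (z ^ m) _ (λ i → z ^ (m ∸ suc (toℕ i))) ⟩
    ζ (k ∷ m ∷ []) z + - (z ^ k) * recursion m (z ^ suc m) (z ^ m) (λ i → z ^ (m ∸ suc (toℕ i)))
      ≈⟨ +-congˡ (*-congˡ (ζ₁-shift m z)) ⟨
    ζ (k ∷ m ∷ []) z + - (z ^ k) * ζ (m ∷ []) (z + 1#)
      ∎
    where
    shift₁ : ∀ n p → n ≡ k ℕ.+ p → ζ (n ∷ []) (z + 1#) ≈ ζ (n ∷ []) z + - (z ^ k) * z ^ p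
    shift₁ .(k ℕ.+ p) p ≡.refl = begin
      ζ (k ℕ.+ p ∷ []) (z + 1#)                             ≈⟨ ζ-shift (k ℕ.+ p) [] z ⟩
      ζ (k ℕ.+ p ∷ []) z + - (z ^ (k ℕ.+ p)) * 1#           ≈⟨ +-congˡ (*-identityʳ _) ⟩
      ζ (k ℕ.+ p ∷ []) z + - (z ^ (k ℕ.+ p))                ≈⟨ +-congˡ (-‿cong (^-homo-* z k p)) ⟩
      ζ (k ℕ.+ p ∷ []) z + - (z ^ k * z ^ p)                ≈⟨ +-congˡ (-‿distribˡ-* _ _) ⟩
      ζ (k ℕ.+ p ∷ []) z + - (z ^ k) * z ^ p                ∎
  ζ-shift {suc (suc r)} k ks z = begin
    ζ (k ∷ ks) (z + 1#)
      ≈⟨ recursion-cong m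
           (ζ-shift k (prefix ∷ʳ (m′ ℕ.+ m ℕ.+ 1)) z)
           (ζ-shift k (prefix ∷ʳ (m′ ℕ.+ m)) z)
           (λ i → ζ-shift k (prefix ∷ʳ (m′ ℕ.+ m ∸ suc (toℕ i))) z) ⟩
    recursion m _ _ _
      ≈⟨ recursion-linear m (- (z ^ k)) _ _ _ _ _
           (λ i → ζ (prefix ∷ʳ (m′ ℕ.+ m ∸ suc (toℕ i))) (z + 1#)) ⟩
    ζ (k ∷ ks) z + - (z ^ k) * ζ ks (z + 1#)
      ∎
    where
    prefix = init (init ks)
    m′     = last (init ks)
    m      = last ks

  ζ-solves : SolvesSystem ζ
  ζ-solves = record
    { depth-zero = λ _ → refl
    ; difference = λ k ks z → trans (+-congʳ (ζ-shift k ks z)) (xyx⁻¹≈y _ _)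
    }

  ζ-cong : ∀ {r} (ks : Vec ℕ r) {x y} → x ≈ y → ζ ks x ≈ ζ ks y
  ζ-cong {zero}        []       x≈y = refl
  ζ-cong {suc zero}    (k ∷ []) x≈y = -‿cong (*-congˡ (sum-cong-≋ {suc (suc k)} λ j →
    *-congˡ {ι (binomial (suc k) (toℕ j) ℚ.* bernoulli (toℕ j))} (^-congˡ (suc k ∸ toℕ j) x≈y)))
  ζ-cong {suc (suc r)} ks       x≈y = recursion-cong (last ks)
    (ζ-cong (init (init ks) ∷ʳ (last (init ks) ℕ.+ last ks ℕ.+ 1)) x≈y)
    (ζ-cong (init (init ks) ∷ʳ (last (init ks) ℕ.+ last ks)) x≈y)
    (λ i → ζ-cong (init (init ks) ∷ʳ (last (init ks) ℕ.+ last ks ∸ suc (toℕ i))) x≈y)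

  solution-unique : ∀ {r} k (ks : Vec ℕ r) (V : Function) → let open Func using (to) in
    SolvesEquation k (ζ ks) (to V) →
    ∃[ P ] (HasPeriodOne P × (∀ z → to V z ≈ ζ (k ∷ ks) z + to P z))
  solution-unique k ks V solves = P , periodic , λ z → sym (trans (+-comm _ _) (x-y+y≈x _ _))
    where
    open Func V using (to)
    P : Function
    P = record
      { to   = λ z → to z - ζ (k ∷ ks) z
      ; cong = λ x≈y → +-cong (Func.cong V x≈y) (-‿cong (ζ-cong (k ∷ ks) x≈y))
      }
    x-y+y≈x : ∀ x y → (x - y) + y ≈ x
    x-y+y≈x x y = trans (+-assoc x (- y) y) (trans (+-congˡ (-‿inverseˡ y)) (+-identityʳ x))
    periodic : HasPeriodOne P
    periodic z = begin
      to (z + 1#) - ζ (k ∷ ks) (z + 1#)                   ≈⟨ +-cong V-shift (-‿cong (ζ-shift k ks z)) ⟩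
      (d + to z) - (ζ (k ∷ ks) z + d)                     ≈⟨ +-congˡ (⁻¹-∙-comm _ _) ⟨
      (d + to z) + (- ζ (k ∷ ks) z + - d)                 ≈⟨ solve 4 (λ d v x e → d :+ v :+ (x :+ e) := d :+ (v :+ x) :+ e) refl _ _ _ _ ⟩
      d + (to z - ζ (k ∷ ks) z) + - d                     ≈⟨ xyx⁻¹≈y d _ ⟩
      to z - ζ (k ∷ ks) z                                 ∎
      where
      d = - (z ^ k) * ζ ks (z + 1#)
      V-shift : to (z + 1#) ≈ d + to z
      V-shift = trans (sym (x-y+y≈x _ _)) (+-congʳ (solves z))

theorem3p1 :
  ∀ {c ℓ} (A : CommutativeRing c ℓ) (ι : ℚ → CommutativeRing.Carrier A) →
  let open CommutativeRing A
      open MultipleZeta A ι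
      open Func using (to)
  in
  IsℚAlgebra →
  SolvesSystem ζ ×
  (∀ {r} (k : ℕ) (ks : Vec ℕ r) (V : Function) →
    SolvesEquation k (ζ ks) (to V) →
    ∃[ P ] (HasPeriodOne P × (∀ z → to V z ≈ ζ (k ∷ ks) z + to P z)))
theorem3p1 A ι isℚAlgebra = ζ-solves , solution-unique
  where open DifferenceEquations A ι isℚAlgebra
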